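{- Let $n$ and $k$ be integers with $3\leq k\leq n$. For every connected graph $G$ of order $n$, $$1\leq \lambda_k(G)\leq n-\lceil k/2\rceil.$$ Moreover, the upper and lower bounds are tight: there is a connected graph of order $n$ attaining the upper bound, and there is a connected graph of order $n$ attaining the lower bound.
   Context: All graphs are undirected, finite and simple. For a graph $G$ and a set $S\subseteq V(G)$ of at least two vertices, a tree connecting $S$ is a subgraph $T$ of $G$ that is a tree with $S\subseteq V(T)$. Let $\lambda(S)$ be the maximum number of pairwise edge-disjoint trees connecting $S$ in $G$. The generalized $k$-edge-connectivity of $G$ is $\lambda_k(G)=\min\{\lambda(S) : S\subseteq V(G),\ |S|=k\}$. -}

module Defs where

open import Data.Bool.Base using (Bool; T)
open import Data.Fin.Base using (Fin)
open import Data.Fin.Subset using (Subset; _∈_; _⊆_; Nonempty; ∣_∣; ⊤)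
open import Data.List.Base using (List; _∷_; _∷ʳ_; length)
open import Data.List.Relation.Unary.Linked using (Linked)
open import Data.List.Relation.Unary.Unique.Propositional using (Unique)
open import Data.Nat.Base using (ℕ; _≤_)
open import Data.Nat.Properties using (≤-antisym)
open import Data.Product.Base using (_×_; _,_; Σ-syntax; ∃-syntax)
open import Level using (0ℓ)
open import Relation.Binary.Construct.Closure.ReflexiveTransitive using (Star)
open import Relation.Binary.Core using (Rel)
open import Relation.Binary.Definitions using (Symmetric; Irreflexive)
open import Relation.Binary.PropositionalEquality.Core using (_≡_; _≢_)
open import Relation.Nullary.Negation.Core using (¬_)

record Graph (n : ℕ) : Set where
  field
    adj : Fin n → Fin n → Bool

  Adj : Rel (Fin n) 0ℓ
  Adj u v = T (adj u v)

  field
    adj-sym    : Symmetric Adj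
    adj-irrefl : Irreflexive _≡_ Adj

module _ {n : ℕ} (V : Subset n) (E : Rel (Fin n) 0ℓ) where

  -- Walks are not explicitly confined to V: in every use below, the
  -- endpoints of E-edges lie in V.
  IsConnected : Set
  IsConnected = Nonempty V × (∀ {u v} → u ∈ V → v ∈ V → Star E u v)

-- The cycle x, x₁, …, xₘ, x on the distinct vertices x ∷ xs.
IsCycle : ∀ {n} → Rel (Fin n) 0ℓ → Fin n → List (Fin n) → Set
IsCycle E x xs = 2 ≤ length xs × Unique (x ∷ xs) × Linked E (x ∷ xs ∷ʳ x)

IsAcyclic : ∀ {n} → Rel (Fin n) 0ℓ → Set
IsAcyclic E = ∀ x xs → ¬ IsCycle E x xs

Connected : ∀ {n} → Graph n → Set
Connected G = IsConnected ⊤ (Graph.Adj G)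

record Subgraph {n : ℕ} (G : Graph n) : Set where
  field
    vertices : Subset n
    adj      : Fin n → Fin n → Bool

  Adj : Rel (Fin n) 0ℓ
  Adj u v = T (adj u v)

  field
    adj-sym      : Symmetric Adj
    adj⇒adjG     : ∀ {u v} → Adj u v → Graph.Adj G u v
    adj⇒vertices : ∀ {u v} → Adj u v → u ∈ vertices × v ∈ vertices

module _ {n : ℕ} {G : Graph n} where

  IsTree : Subgraph G → Set
  IsTree H = IsConnected vertices Adj × IsAcyclic Adj
    where open Subgraph H

  IsTreeConnecting : Subset n → Subgraph G → Set
  IsTreeConnecting S H = IsTree H × S ⊆ Subgraph.vertices H

  EdgeDisjoint : Subgraph G → Subgraph G → Set
  EdgeDisjoint H K = ∀ u v → ¬ (Subgraph.Adj H u v × Subgraph.Adj K u v)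

module _ {n : ℕ} (G : Graph n) where

  HasDisjointTrees : Subset n → ℕ → Set
  HasDisjointTrees S m =
    Σ[ tree ∈ (Fin m → Subgraph G) ]
      (∀ i → IsTreeConnecting S (tree i)) ×
      (∀ i j → i ≢ j → EdgeDisjoint (tree i) (tree j))

  -- Isλ S m says λ(S) = m. It is meant for 2 ≤ ∣ S ∣: an edgeless
  -- one-vertex tree is edge-disjoint from itself, so for a singleton S
  -- no maximum exists.
  Isλ : Subset n → ℕ → Set
  Isλ S m = HasDisjointTrees S m × (∀ m′ → HasDisjointTrees S m′ → m′ ≤ m)

  -- Isλₖ k l says λₖ(G) = l.
  Isλₖ : ℕ → ℕ → Set
  Isλₖ k l =
    (∃[ S ] ∣ S ∣ ≡ k × Isλ S l) ×
    (∀ S m → ∣ S ∣ ≡ k → Isλ S m → l ≤ m)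

  Isλ-unique : ∀ {S m m′} → Isλ S m → Isλ S m′ → m ≡ m′
  Isλ-unique (p , p-max) (q , q-max) = ≤-antisym (q-max _ p) (p-max _ q)

  Isλₖ-unique : ∀ {k l l′} → Isλₖ k l → Isλₖ k l′ → l ≡ l′
  Isλₖ-unique ((S , ∣S∣≡k , p) , p-min) ((S′ , ∣S′∣≡k , q) , q-min) =
    ≤-antisym (p-min S′ _ ∣S′∣≡k q) (q-min S _ ∣S∣≡k p)

{-# OPTIONS --safe #-}
module Submission where

-- A family of m edge-disjoint trees connecting S is the same as a colouring of
-- the edges in which each of m colours connects S, because every connected
-- component has a spanning tree. There are finitely many colourings, so λ(S)
-- and λₖ can be computed by search. Weighting the edges within S by 1/(k − 1)
-- and those leaving S by 1/k gives every tree weight at least 1 and all edges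
-- together weight n − k/2, which is the upper bound. It is attained by complete
-- graphs; in a star, an edge at a leaf in S is needed by every tree.

open import Data.Bool.Base
  using (Bool; true; false; if_then_else_; not; _xor_; T)
open import Data.Bool.Properties using (T?; xor-comm)
open import Data.Fin.Base using (Fin; zero; suc; toℕ; fromℕ<; inject≤)
open import Data.Fin.Properties as Fin
  using (_≟_; any?; all?; toℕ<n; toℕ-fromℕ<; toℕ-injective)
open import Data.Fin.Subset
  using (Subset; inside; outside; _∈_; _∉_; _⊃_; _∪_; _-_; ⁅_⁆; ∁; ⊥; ∣_∣;
    Nonempty)
open import Data.Fin.Subset.Induction using (Acc; acc; ⊃-wellFounded)
open import Data.Fin.Subset.Properties
  using (_∈?_; x∈⁅x⁆; x∈⁅y⁆⇒x≡y; x∈p∪q⁻; p⊆p∪q; q⊆p∪q; p⊆q⇒∣p∣≤∣q∣; drop-there;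
    ∣p∣≤∣x∷p∣; x∈p∧x≢y⇒x∈p-y; ⊂-irref; p─q─q≡p─q; x∈p⇒p-x⊂p; p─q⊆p; nonempty?;
    Empty-unique; ∣⊥∣≡0; ∣∁p∣≡n∸∣p∣; anySubset?; ∈⊤; x∈∁p⇒x∉p)
open import Data.List.Base using ([]; _∷_; _∷ʳ_)
import Data.List.Membership.Propositional as List
open import Data.List.Relation.Unary.All as All using (All; []; _∷_)
open import Data.List.Relation.Unary.AllPairs using (_∷_)
open import Data.List.Relation.Unary.Any using (here; there)
open import Data.List.Relation.Unary.Linked using (Linked; [-]; _∷_)
open import Data.List.Relation.Unary.Unique.Propositional using (Unique)
open import Data.Nat.Base
  using (ℕ; zero; suc; _+_; _*_; _∸_; _≤_; _<_; _⊔_; _⊓_; ⌊_/2⌋; ⌈_/2⌉; NonZero;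
    z≤n; s≤s; z<s; s≤s⁻¹)
open import Data.Nat.Induction using (<-wellFounded)
open import Data.Nat.Properties as ℕ
  using (*-cancelˡ-≤; *-distribʳ-+; *-distribˡ-+; *-identityˡ; *-monoˡ-≤; *-zeroʳ;
    +-assoc; +-cancelˡ-<; +-cancelˡ-≤; +-comm; +-identityʳ; +-mono-≤; +-suc;
    +-∸-assoc; 1+n≢n; <-asym; <-irrefl; <-trans; <⇒≤; m*n≢0; m+[n∸m]≡n;
    m+n∸n≡m; m∸n+n≡m; m≤m+n; m≤n+m; m≤n⇒m≤o+n; m≤n⇒m⊔n≡n; m≥n⇒m⊓n≡n; n<1+n;
    n≡⌈n+n/2⌉; n≡⌊n+n/2⌋; n≤1+n; ≤-antisym; ≤-refl; ≤-reflexive; ≤-total;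
    ≤-trans; ≮⇒≥; ⌈n/2⌉≤n; ⌊n/2⌋+⌈n/2⌉≡n; ⌊n/2⌋-mono; ⌊n/2⌋≤⌈n/2⌉; _<?_;
    ⊔-comm; ⊓-comm; ⊔-idem; +-*-semiring; module ≤-Reasoning)
open import Data.Nat.Tactic.RingSolver using (solve-∀)
open import Data.Product.Base
  using (_×_; _,_; proj₁; proj₂; Σ-syntax; ∃-syntax; ∃)
open import Data.Sum.Base using (_⊎_; inj₁; inj₂; swap)
open import Data.Unit.Base using (tt)
open import Data.Vec.Base using (Vec; []; _∷_; here; there; lookup; tabulate)
open import Data.Vec.Properties using (lookup∘tabulate; []=⇒lookup; lookup⇒[]=)
open import Function.Base using (_∘_)
open import Level using (0ℓ)
open import Relation.Binary.Construct.Closure.ReflexiveTransitive as Star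
  using (Star; ε; _◅_; _◅◅_; reverse)
open import Relation.Binary.Core using (Rel)
open import Relation.Binary.Definitions using (Symmetric)
  renaming (Decidable to Decidable₂)
open import Relation.Binary.PropositionalEquality
  using (_≡_; _≢_; refl; sym; trans; cong; cong₂; subst; ≢-sym; module ≡-Reasoning)
open import Relation.Nullary.Decidable
  using (Dec; yes; no; does; ⌊_⌋; toWitness; fromWitness; toWitnessFalse;
    fromWitnessFalse; map′; ¬?; _×-dec_; _⊎-dec_; _→-dec_; dec-true;
    dec-false; decidable-stable)
open import Relation.Nullary.Negation using (¬_; contradiction)
open import Relation.Unary using (Decidable)
open import Defs
open import Algebra.Properties.Semiring.Sum +-*-semiring
  using (sum; ∑-distrib-+; ∑-comm; sum-cong-≗; sum-replicate-zero; *-distribʳ-sum)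

-- `Isλₖ` asks for an actual set and an actual maximum, so the existence of λₖ is itself a claim;
-- constructively it rests on deciding whether a set has m disjoint trees. Colourings are easy to
-- enumerate, and they are also forgiving: a class only has to connect `S`, and surplus edges or
-- cycles in it do no harm, since a spanning tree is extracted afterwards. The same freedom serves
-- the upper bound, which uses only that each class connects `S`, and the complete graph, whose
-- labelling may put stray edges into a class. The total weight is k(k - 1)/2 · 1/(k - 1) + k(n - k)
-- · 1/k = k/2 + (n - k). The number of trees is an integer, so it is at most (n - k) + ⌊k/2⌋, which
-- is n - ⌈k/2⌉. The complete graph meets this term by term: n - k stars centred outside `S` and
-- ⌊k/2⌋ double stars inside it.

private
  variable
    m n : ℕ

-- Growing a rooted spanning tree of a component

-- Parent pointers with a strictly decreasing depth: the depth makes climbing terminate and decides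
-- which end of an edge is the child. The values of `parent` and `depth` off `vertices` are
-- arbitrary.
record RootedTree (E : Rel (Fin n) 0ℓ) (r : Fin n) : Set where
  field
    vertices : Subset n
    parent   : Fin n → Fin n
    depth    : Fin n → ℕ
    root∈    : r ∈ vertices
    climb    : ∀ {v} → v ∈ vertices → v ≢ r →
               parent v ∈ vertices × E (parent v) v × depth (parent v) < depth v

  -- Closure under `E`: together with `root∈` and `climb` it makes `vertices` the whole component of
  -- `r` when `E` is symmetric.
  Spanning : Set
  Spanning = ∀ {u v} → u ∈ vertices → E u v → v ∈ vertices

module _ {E : Rel (Fin n) 0ℓ} {r : Fin n} where
  open RootedTree

  -- `y` is new, so giving it a parent and a depth leaves the data of all old vertices intact.
  graft : (t : RootedTree E r) → ∀ {x y} →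
          x ∈ vertices t → y ∉ vertices t → E x y →
          Σ[ t′ ∈ RootedTree E r ] vertices t′ ⊃ vertices t
  graft t {x} {y} x∈ y∉ xy =
    record
      { vertices = vertices t ∪ ⁅ y ⁆
      ; parent   = parent′
      ; depth    = depth′
      ; root∈    = p⊆p∪q _ (root∈ t)
      ; climb    = climb′
      } , p⊆p∪q _ , y , q⊆p∪q _ _ (x∈⁅x⁆ y) , y∉
    where
    parent′ : Fin _ → Fin _
    parent′ v with v ≟ y
    ... | yes _ = x
    ... | no  _ = parent t v

    depth′ : Fin _ → ℕ
    depth′ v with v ≟ y
    ... | yes _ = suc (depth t x)
    ... | no  _ = depth t v

    depth′≡depth : ∀ {v} → v ∈ vertices t → depth′ v ≡ depth t v
    depth′≡depth {v} v∈ with v ≟ y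
    ... | yes refl = contradiction v∈ y∉
    ... | no  _    = refl

    climb′ : ∀ {v} → v ∈ vertices t ∪ ⁅ y ⁆ → v ≢ r →
             parent′ v ∈ vertices t ∪ ⁅ y ⁆ × E (parent′ v) v ×
             depth′ (parent′ v) < depth′ v
    climb′ {v} v∈ v≢r with v ≟ y
    ... | yes refl rewrite depth′≡depth x∈ = p⊆p∪q _ x∈ , xy , n<1+n _
    ... | no v≢y with x∈p∪q⁻ _ _ v∈
    ...   | inj₂ v∈⁅y⁆ = contradiction (x∈⁅y⁆⇒x≡y y v∈⁅y⁆) v≢y
    ...   | inj₁ v∈t with climb t v∈t v≢r
    ...     | p∈ , pv , p< rewrite depth′≡depth p∈ = p⊆p∪q _ p∈ , pv , p<

  module _ (E? : Decidable₂ E) where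

    -- Each graft enlarges the vertex set strictly, so the process stops, and it can only stop when
    -- no edge leaves the tree.
    grow : (t : RootedTree E r) → Acc _⊃_ (vertices t) →
           ∃[ t′ ] Spanning {E = E} {r} t′
    grow t (acc rs)
      with any? (λ x → any? (λ y → x ∈? vertices t ×-dec ¬? (y ∈? vertices t) ×-dec E? x y))
    ... | yes (x , y , x∈ , y∉ , xy) with graft t x∈ y∉ xy
    ...   | t′ , t′⊃t = grow t′ (rs t′⊃t)
    grow t (acc rs) | no none = t , closed
      where
      closed : Spanning t
      closed {u} {v} u∈ uv with v ∈? vertices t
      ... | yes v∈ = v∈
      ... | no  v∉ = contradiction (u , v , u∈ , v∉ , uv) none

    spanningTree : ∃[ t ] Spanning {E = E} {r} t
    spanningTree = grow seed (⊃-wellFounded _)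
      where
      seed : RootedTree E r
      seed = record
        { vertices = ⁅ r ⁆
        ; parent   = λ v → v
        ; depth    = λ _ → 0
        ; root∈    = x∈⁅x⁆ r
        ; climb    = λ v∈ v≢r → contradiction (x∈⁅y⁆⇒x≡y r v∈) v≢r
        }

  reachable⇒∈ : (t : RootedTree E r) → Spanning t → ∀ {u v} →
                u ∈ vertices t → Star E u v → v ∈ vertices t
  reachable⇒∈ t closed u∈ ε          = u∈
  reachable⇒∈ t closed u∈ (uw ◅ wv) = reachable⇒∈ t closed (closed u∈ uw) wv

  module _ (t : RootedTree E r) where

    ChildOf : Rel (Fin n) 0ℓ
    ChildOf v u = v ∈ vertices t × v ≢ r × u ≡ parent t v

    TreeEdge : Rel (Fin n) 0ℓ
    TreeEdge u v = ChildOf u v ⊎ ChildOf v u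

    treeEdge? : Decidable₂ TreeEdge
    treeEdge? u v = child? u v ⊎-dec child? v u
      where
      child? : Decidable₂ ChildOf
      child? v u = v ∈? vertices t ×-dec ¬? (v ≟ r) ×-dec u ≟ parent t v

    root-path : ∀ {v} → v ∈ vertices t → Star TreeEdge v r
    root-path {v} v∈ = go v v∈ (<-wellFounded (depth t v))
      where
      go : ∀ v → v ∈ vertices t → Acc _<_ (depth t v) → Star TreeEdge v r
      go v v∈ (acc rs) with v ≟ r
      ... | yes refl = ε
      ... | no v≢r with climb t v∈ v≢r
      ...   | p∈ , _ , p< = inj₁ (v∈ , v≢r , refl) ◅ go (parent t v) p∈ (rs p<)

    tree-connected : ∀ {u v} → u ∈ vertices t → v ∈ vertices t → Star TreeEdge u v
    tree-connected u∈ v∈ = root-path u∈ ◅◅ reverse swap (root-path v∈)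

    treeEdge⇒E : Symmetric E → ∀ {u v} → TreeEdge u v → E u v
    treeEdge⇒E E-sym (inj₁ (u∈ , u≢r , refl)) = E-sym (proj₁ (proj₂ (climb t u∈ u≢r)))
    treeEdge⇒E E-sym (inj₂ (v∈ , v≢r , refl)) = proj₁ (proj₂ (climb t v∈ v≢r))

    treeEdge⇒∈ : ∀ {u v} → TreeEdge u v → u ∈ vertices t × v ∈ vertices t
    treeEdge⇒∈ (inj₁ (u∈ , u≢r , refl)) = u∈ , proj₁ (climb t u∈ u≢r)
    treeEdge⇒∈ (inj₂ (v∈ , v≢r , refl)) = proj₁ (climb t v∈ v≢r) , v∈

-- Parent pointers exclude cycles

-- A closed walk that never backtracks cannot exist: after a step away from
-- the root every further step leads away from the root, since a vertex has
-- only one parent.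
module _ {T : Rel (Fin n) 0ℓ} (p : Fin n → Fin n) (d : Fin n → ℕ)
         (oriented : ∀ {u v} → T u v →
                     (v ≡ p u × d v < d u) ⊎ (u ≡ p v × d u < d v)) where

  -- The step just taken led from `a` down to `b`, and `x` is where the cycle will close. A step up
  -- from `b` could only return to `a`, so the walk goes down all the way, and its last vertex
  -- before `x` is the parent of `x`.
  descend : ∀ {x a} b l → a ≡ p b → Linked T (b ∷ l ∷ʳ x) →
            All (a ≢_) (b ∷ l) → Unique (b ∷ l) → x ≢ a → All (x ≢_) (b ∷ l) →
            d b < d x × p x List.∈ b ∷ l
  descend b [] a≡pb (bx ∷ [-]) _ _ x≢a _ with oriented bx
  ... | inj₁ (x≡pb , _)    = contradiction (trans x≡pb (sym a≡pb)) x≢a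
  ... | inj₂ (b≡px , b<x) = b<x , here (sym b≡px)
  descend b (c ∷ l) a≡pb (bc ∷ walk) (_ ∷ a≢c ∷ _) (b≢ ∷ uniq) _ (x≢b ∷ x≢)
    with oriented bc
  ... | inj₁ (c≡pb , _)    = contradiction (trans a≡pb (sym c≡pb)) a≢c
  ... | inj₂ (b≡pc , b<c) with descend c l b≡pc walk b≢ uniq x≢b x≢
  ...   | c<x , px∈ = <-trans b<c c<x , there px∈

  -- Either the walk climbs all the way to `x`, or it turns downwards once and `descend` takes over.
  ascend : ∀ {x} b l → Linked T (b ∷ l ∷ʳ x) → Unique (b ∷ l) → All (x ≢_) (b ∷ l) →
           d x < d b ⊎ p x List.∈ b ∷ l
  ascend b [] (bx ∷ [-]) _ _ with oriented bx
  ... | inj₁ (_ , x<b)  = inj₁ x<b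
  ... | inj₂ (b≡px , _) = inj₂ (here (sym b≡px))
  ascend b (c ∷ l) (bc ∷ walk) (b≢ ∷ uniq) (x≢b ∷ x≢) with oriented bc
  ... | inj₂ (b≡pc , _) = inj₂ (there (proj₂ (descend c l b≡pc walk b≢ uniq x≢b x≢)))
  ... | inj₁ (_ , c<b) with ascend c l walk uniq x≢
  ...   | inj₁ x<c = inj₁ (<-trans x<c c<b)
  ...   | inj₂ px∈ = inj₂ (there px∈)

  -- Down then up returns to `x` at once; down twice puts `x` below itself. If the first step goes
  -- up, then `y` is the parent of `x`; the rest of the walk either climbs, putting `x` above
  -- itself, or ends by stepping down to `x` from its parent, a later vertex than `y`.
  oriented⇒acyclic : IsAcyclic T
  oriented⇒acyclic x []          (() , _)
  oriented⇒acyclic x (_ ∷ [])    (s≤s () , _)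
  oriented⇒acyclic x (y ∷ z ∷ l)
    (_ , (x≢y ∷ x≢z ∷ x≢) ∷ (y≢ ∷ uniq) , xy ∷ yz ∷ walk) with oriented xy | oriented yz
  ... | inj₂ (x≡py , _)    | inj₁ (z≡py , _)  = x≢z (trans x≡py (sym z≡py))
  ... | inj₂ (_ , x<y)     | inj₂ (y≡pz , y<z)
      = <-irrefl refl (<-trans x<y (<-trans y<z
          (proj₁ (descend z l y≡pz walk y≢ uniq x≢y (x≢z ∷ x≢)))))
  ... | inj₁ (y≡px , _)    | inj₂ (y≡pz , _)
      = All.lookup y≢ (proj₂ (descend z l y≡pz walk y≢ uniq x≢y (x≢z ∷ x≢))) y≡px
  ... | inj₁ (y≡px , y<x)  | inj₁ (_ , z<y) with ascend z l walk uniq (x≢z ∷ x≢)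
  ...   | inj₁ x<z = <-irrefl refl (<-trans x<z (<-trans z<y y<x))
  ...   | inj₂ px∈ = All.lookup y≢ px∈ y≡px

module _ {G : Graph n} {E : Rel (Fin n) 0ℓ} {r : Fin n}
         (E-sym : Symmetric E) (E⇒G : ∀ {u v} → E u v → Graph.Adj G u v) where
  open RootedTree

  subgraph : RootedTree E r → Subgraph G
  subgraph t = record
    { vertices     = vertices t
    ; adj          = λ u v → ⌊ treeEdge? t u v ⌋
    ; adj-sym      = λ {u} {v} uv → fromWitness (swap (toWitness {a? = treeEdge? t u v} uv))
    ; adj⇒adjG     = λ {u} {v} uv →
        E⇒G (treeEdge⇒E t E-sym (toWitness {a? = treeEdge? t u v} uv))
    ; adj⇒vertices = λ {u} {v} uv → treeEdge⇒∈ t (toWitness {a? = treeEdge? t u v} uv)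
    }

  subgraph-adj : ∀ t {u v} → Subgraph.Adj (subgraph t) u v → E u v
  subgraph-adj t {u} {v} uv = treeEdge⇒E t E-sym (toWitness {a? = treeEdge? t u v} uv)

  subgraph-isTree : (t : RootedTree E r) → IsTree (subgraph t)
  subgraph-isTree t =
    ((r , root∈ t) , λ u∈ v∈ → Star.map fromWitness (tree-connected t u∈ v∈)) ,
    oriented⇒acyclic (parent t) (depth t) orient
    where
    orient : ∀ {u v} → T ⌊ treeEdge? t u v ⌋ →
             (v ≡ parent t u × depth t v < depth t u) ⊎
             (u ≡ parent t v × depth t u < depth t v)
    orient {u} {v} uv with toWitness {a? = treeEdge? t u v} uv
    ... | inj₁ (u∈ , u≢r , refl) = inj₁ (refl , proj₂ (proj₂ (climb t u∈ u≢r)))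
    ... | inj₂ (v∈ , v≢r , refl) = inj₂ (refl , proj₂ (proj₂ (climb t v∈ v≢r)))

-- Reachability from `u` is membership in the spanning tree grown from `u`.
star? : {E : Rel (Fin n) 0ℓ} → Symmetric E → Decidable₂ E → Decidable₂ (Star E)
star? E-sym E? u v with spanningTree {r = u} E?
... | t , closed = map′
  (λ v∈ → reverse E-sym (Star.map (treeEdge⇒E t E-sym) (root-path t v∈)))
  (reachable⇒∈ t closed (RootedTree.root∈ t))
  (v ∈? RootedTree.vertices t)

-- Colourings and their exhaustive search

Searchable : Set → Set₁
Searchable A = {P : A → Set} → Decidable P → Dec (∃ P)

anyVec? : {A : Set} → Searchable A → ∀ n → Searchable (Vec A n)
anyVec? any-A? zero    P? = map′ ([] ,_) (λ { ([] , p) → p }) (P? [])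
anyVec? any-A? (suc n) P? =
  map′ (λ { (x , xs , p) → x ∷ xs , p }) (λ { (x ∷ xs , p) → x , xs , p })
       (any-A? λ x → anyVec? any-A? n (P? ∘ (x ∷_)))

-- Colour zero marks the edges that belong to no class.
Colouring : ℕ → ℕ → Set
Colouring n m = Fin n → Fin n → Fin (suc m)

Connecting : Rel (Fin n) 0ℓ → Subset n → Set
Connecting E S = ∀ s t → s ∈ S → t ∈ S → Star E s t

module _ (G : Graph n) where
  open Graph G

  -- Requiring the colour in both directions makes classes symmetric without imposing symmetry on
  -- colourings, so the search runs over all tables.
  Class : Colouring n m → Fin m → Rel (Fin n) 0ℓ
  Class c i u v = Adj u v × c u v ≡ suc i × c v u ≡ suc i

  Connects : Colouring n m → Subset n → Set
  Connects c S = ∀ i → Connecting (Class c i) S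

  class-sym : (c : Colouring n m) (i : Fin m) → Symmetric (Class c i)
  class-sym c i (uv , cuv , cvu) = adj-sym uv , cvu , cuv

  class? : (c : Colouring n m) (i : Fin m) → Decidable₂ (Class c i)
  class? c i u v = T? (adj u v) ×-dec c u v ≟ suc i ×-dec c v u ≟ suc i

  connects? : ∀ S → Decidable (λ (c : Colouring n m) → Connects c S)
  connects? S c = all? λ i → all? λ s → all? λ t →
    s ∈? S →-dec t ∈? S →-dec star? (class-sym c i) (class? c i) s t

  -- A colouring sent through a table of vectors comes back only pointwise equal, and function
  -- extensionality is not assumed.
  Connects-resp-≗ : ∀ {S} {c c′ : Colouring n m} → (∀ u v → c u v ≡ c′ u v) →
                    Connects c S → Connects c′ S
  Connects-resp-≗ c≗c′ conn i s t s∈ t∈ = Star.map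
    (λ { (uv , cuv , cvu) → uv , trans (sym (c≗c′ _ _)) cuv , trans (sym (c≗c′ _ _)) cvu })
    (conn i s t s∈ t∈)

  anyColouring? : ∀ S → Dec (∃ λ (c : Colouring n m) → Connects c S)
  anyColouring? S = map′
    (λ { (xss , conn) → color xss , conn })
    (λ { (c , conn) → tabulate (tabulate ∘ c) ,
                      Connects-resp-≗ (λ u v → sym (color∘tabulate c u v)) conn })
    (anyVec? (anyVec? any? n) n (connects? S ∘ color))
    where
    color : Vec (Vec (Fin _) n) n → Colouring n _
    color xss u v = lookup (lookup xss u) v

    color∘tabulate : ∀ c u v → color (tabulate (tabulate ∘ c)) u v ≡ c u v
    color∘tabulate c u v
      rewrite lookup∘tabulate (tabulate ∘ c) u = lookup∘tabulate (c u) v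

  disjointTrees : ∀ {S} → Nonempty S → (c : Colouring n m) → Connects c S →
                  HasDisjointTrees G S m
  disjointTrees {m} {S} (r , r∈) c conn = tree , tree-connecting , disjoint
    where
    spanning : ∀ i → ∃[ t ] RootedTree.Spanning {E = Class c i} {r} t
    spanning i = spanningTree (class? c i)

    tree : Fin m → Subgraph G
    tree i = subgraph (class-sym c i) proj₁ (proj₁ (spanning i))

    tree-connecting : ∀ i → IsTreeConnecting S (tree i)
    tree-connecting i =
      subgraph-isTree {G = G} (class-sym c i) proj₁ t ,
      λ s∈ → reachable⇒∈ t closed (RootedTree.root∈ t) (conn i _ _ r∈ s∈)
      where
      t = proj₁ (spanning i)
      closed = proj₂ (spanning i)

    disjoint : ∀ i j → i ≢ j → EdgeDisjoint (tree i) (tree j)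
    disjoint i j i≢j u v (uvᵢ , uvⱼ)
      with subgraph-adj {G = G} (class-sym c i) proj₁ (proj₁ (spanning i)) uvᵢ
         | subgraph-adj {G = G} (class-sym c j) proj₁ (proj₁ (spanning j)) uvⱼ
    ... | _ , cᵢ , _ | _ , cⱼ , _ = i≢j (Fin.suc-injective (trans (sym cᵢ) cⱼ))

  -- An edge takes the colour of the tree containing it; by disjointness the choice made by `any?`
  -- does not matter.
  treeColouring : ∀ {S} → HasDisjointTrees G S m → ∃ λ (c : Colouring n m) → Connects c S
  treeColouring {m} {S} (tree , connecting , disjoint) = c , conn
    where
    edge? : ∀ u v → Dec (∃ λ i → Subgraph.Adj (tree i) u v)
    edge? u v = any? λ i → T? (Subgraph.adj (tree i) u v)

    c : Colouring n m
    c u v with edge? u v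
    ... | yes (i , _) = suc i
    ... | no  _       = zero

    c-tree : ∀ i {u v} → Subgraph.Adj (tree i) u v → c u v ≡ suc i
    c-tree i {u} {v} uvᵢ with edge? u v
    ... | no ∄        = contradiction (i , uvᵢ) ∄
    ... | yes (j , uvⱼ) with j ≟ i
    ...   | yes refl = refl
    ...   | no  j≢i  = contradiction (uvⱼ , uvᵢ) (disjoint j i j≢i u v)

    conn : Connects c S
    conn i s t s∈ t∈ with connecting i
    ... | ((_ , walk) , _) , S⊆ = Star.map
      (λ uv → Subgraph.adj⇒adjG (tree i) uv , c-tree i uv ,
             c-tree i (Subgraph.adj-sym (tree i) uv))
      (walk (S⊆ s∈) (S⊆ t∈))

  hasDisjointTrees? : ∀ {S} → Nonempty S → ∀ m → Dec (HasDisjointTrees G S m)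
  hasDisjointTrees? {S} S≢∅ m =
    map′ (λ { (c , conn) → disjointTrees S≢∅ c conn }) treeColouring (anyColouring? S)

  fewerTrees : ∀ {S l} → l ≤ m → HasDisjointTrees G S m → HasDisjointTrees G S l
  fewerTrees l≤m (tree , connecting , disjoint) =
    tree ∘ inj , connecting ∘ inj ,
    λ i j i≢j → disjoint (inj i) (inj j) (i≢j ∘ Fin.inject≤-injective l≤m l≤m i j)
    where
    inj = λ i → inject≤ i l≤m

-- Double counting with finite sums

sum-mono : {f g : Fin n → ℕ} → (∀ i → f i ≤ g i) → sum f ≤ sum g
sum-mono {zero}  f≤g = z≤n
sum-mono {suc n} f≤g = +-mono-≤ (f≤g zero) (sum-mono (f≤g ∘ suc))

term≤sum : (f : Fin n → ℕ) (i : Fin n) → f i ≤ sum f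
term≤sum f zero    = m≤m+n _ _
term≤sum f (suc i) = ≤-trans (term≤sum (f ∘ suc) i) (m≤n+m _ _)

n*b≤sum : (f : Fin n → ℕ) (b : ℕ) → (∀ i → b ≤ f i) → n * b ≤ sum f
n*b≤sum {zero}  f b b≤f = z≤n
n*b≤sum {suc n} f b b≤f = +-mono-≤ (b≤f zero) (n*b≤sum (f ∘ suc) b (b≤f ∘ suc))

∣p∣*b≤sum : ∀ (p : Subset n) (f : Fin n → ℕ) b →
            (∀ {i} → i ∈ p → b ≤ f i) → ∣ p ∣ * b ≤ sum f
∣p∣*b≤sum []            f b b≤f = z≤n
∣p∣*b≤sum (inside  ∷ p) f b b≤f =
  +-mono-≤ (b≤f here) (∣p∣*b≤sum p (f ∘ suc) b (b≤f ∘ there))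
∣p∣*b≤sum (outside ∷ p) f b b≤f =
  m≤n⇒m≤o+n _ (∣p∣*b≤sum p (f ∘ suc) b (b≤f ∘ there))

sum-if : ∀ (p : Subset n) a b →
         sum (λ i → if lookup p i then a else b) ≡ ∣ p ∣ * a + ∣ ∁ p ∣ * b
sum-if []            a b = refl
sum-if (inside  ∷ p) a b rewrite sum-if p a b = sym (+-assoc a (∣ p ∣ * a) _)
sum-if (outside ∷ p) a b rewrite sum-if p a b = lemma b (∣ p ∣ * a) (∣ ∁ p ∣ * b)
  where
  lemma : ∀ x y z → x + (y + z) ≡ y + (x + z)
  lemma = solve-∀

ind : {P : Set} → Dec P → ℕ
ind P? = if does P? then 1 else 0

ind≡1 : {P : Set} (P? : Dec P) → P → ind P? ≡ 1
ind≡1 P? p rewrite dec-true P? p = refl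

ind≡0 : {P : Set} (P? : Dec P) → ¬ P → ind P? ≡ 0
ind≡0 P? ¬p rewrite dec-false P? ¬p = refl

exclusive⇒sum≤1 : {P : Fin n → Set} (P? : ∀ i → Dec (P i)) →
                  (∀ i j → P i → P j → i ≡ j) → sum (λ i → ind (P? i)) ≤ 1
exclusive⇒sum≤1 {zero}  P? exclusive = z≤n
exclusive⇒sum≤1 {suc n} P? exclusive with P? zero
... | no _  = exclusive⇒sum≤1 (P? ∘ suc)
  λ i j pᵢ pⱼ → Fin.suc-injective (exclusive _ _ pᵢ pⱼ)
... | yes p₀ = s≤s (≤-trans
  (sum-mono {g = λ _ → 0} λ i →
    ≤-reflexive (ind≡0 (P? (suc i)) λ pᵢ → Fin.0≢1+n (exclusive _ _ p₀ pᵢ)))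
  (≤-reflexive (sum-replicate-zero n)))

∑∑ : (Fin n → Fin n → ℕ) → ℕ
∑∑ f = sum λ u → sum (f u)

∑∑-cong : {f g : Fin n → Fin n → ℕ} → (∀ u v → f u v ≡ g u v) → ∑∑ f ≡ ∑∑ g
∑∑-cong f≗g = sum-cong-≗ (λ u → sum-cong-≗ (f≗g u))

∑∑-distrib-+ : (f g : Fin n → Fin n → ℕ) → ∑∑ (λ u v → f u v + g u v) ≡ ∑∑ f + ∑∑ g
∑∑-distrib-+ f g = trans (sum-cong-≗ (λ u → ∑-distrib-+ (f u) (g u)))
                         (∑-distrib-+ (sum ∘ f) (sum ∘ g))

module _ {E : Rel (Fin n) 0ℓ} (E-sym : Symmetric E) (E? : Decidable₂ E)
         (w : Fin n → Fin n → ℕ) where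

  -- No edge is counted twice, since depth decides which end is the child.
  parentEdges≤weight :
    (parent : Fin n → Fin n) (depth : Fin n → ℕ) (p : Subset n) (b : ℕ) →
    (∀ {u} → u ∈ p → E (parent u) u × depth (parent u) < depth u ×
                      b ≤ w u (parent u) + w (parent u) u) →
    ∣ p ∣ * b ≤ ∑∑ (λ u v → ind (E? u v) * w u v)
  parentEdges≤weight parent depth p b climb = begin
    ∣ p ∣ * b
      ≤⟨ ∣p∣*b≤sum p _ b (λ u∈ → row u∈) ⟩
    ∑∑ (λ u v → χ u v * (w u v + w v u))
      ≡⟨ ∑∑-cong (λ u v → *-distribˡ-+ (χ u v) _ _) ⟩
    ∑∑ (λ u v → χ u v * w u v + χ u v * w v u)
      ≡⟨ ∑∑-distrib-+ (λ u v → χ u v * w u v) _ ⟩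
    ∑∑ (λ u v → χ u v * w u v) + ∑∑ (λ u v → χ u v * w v u)
      -- Exchanging the two summations moves the transposition from the weight to the indicator, so
      -- that `χ u v + χ v u` can be compared with one edge of `E`.
      ≡⟨ cong (∑∑ (λ u v → χ u v * w u v) +_) (∑-comm (λ u v → χ u v * w v u)) ⟩
    ∑∑ (λ u v → χ u v * w u v) + ∑∑ (λ u v → χ v u * w u v)
      ≡⟨ ∑∑-distrib-+ (λ u v → χ u v * w u v) _ ⟨
    ∑∑ (λ u v → χ u v * w u v + χ v u * w u v)
      ≡⟨ ∑∑-cong (λ u v → *-distribʳ-+ (w u v) (χ u v) (χ v u)) ⟨
    ∑∑ (λ u v → (χ u v + χ v u) * w u v)
      ≤⟨ sum-mono (λ u → sum-mono (λ v → *-monoˡ-≤ (w u v) (χ+χ≤E u v))) ⟩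
    ∑∑ (λ u v → ind (E? u v) * w u v) ∎
    where
    open ≤-Reasoning
    child? : ∀ u v → Dec (u ∈ p × v ≡ parent u)
    child? u v = u ∈? p ×-dec v ≟ parent u

    χ : Fin n → Fin n → ℕ
    χ u v = ind (child? u v)

    row : ∀ {u} → u ∈ p → b ≤ sum (λ v → χ u v * (w u v + w v u))
    row {u} u∈ = begin
      b                                          ≤⟨ proj₂ (proj₂ (climb u∈)) ⟩
      w u (parent u) + w (parent u) u            ≡⟨ *-identityˡ _ ⟨
      1 * (w u (parent u) + w (parent u) u)
        ≡⟨ cong (_* (w u (parent u) + w (parent u) u))
                (ind≡1 (child? u (parent u)) (u∈ , refl)) ⟨
      χ u (parent u) * (w u (parent u) + w (parent u) u)
        ≤⟨ term≤sum (λ v → χ u v * (w u v + w v u)) (parent u) ⟩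
      sum (λ v → χ u v * (w u v + w v u))        ∎

    χ+χ≤E : ∀ u v → χ u v + χ v u ≤ ind (E? u v)
    χ+χ≤E u v = go (child? u v) (child? v u)
      where
      go : (uv : Dec (u ∈ p × v ≡ parent u)) (vu : Dec (v ∈ p × u ≡ parent v)) →
           ind uv + ind vu ≤ ind (E? u v)
      go (no _) (no _) = z≤n
      go (yes (u∈ , refl)) (no _)
        rewrite ind≡1 (E? u v) (E-sym (proj₁ (climb u∈))) = ≤-refl
      go (no _) (yes (v∈ , refl)) rewrite ind≡1 (E? u v) (proj₁ (climb v∈)) = ≤-refl
      go (yes (u∈ , v≡pu)) (yes (v∈ , u≡pv)) = contradiction
        (subst (λ x → depth x < depth u) (sym v≡pu) (proj₁ (proj₂ (climb u∈))))
        (<-asym (subst (λ x → depth x < depth v) (sym u≡pv) (proj₁ (proj₂ (climb v∈)))))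

∣p∣≤1+∣q∣ : ∀ {p q : Subset n} x → (∀ {y} → y ∈ p → y ≢ x → y ∈ q) → ∣ p ∣ ≤ suc ∣ q ∣
∣p∣≤1+∣q∣ {p = s ∷ p} {t ∷ q} zero p⊆q = ≤-trans (∣s∷p∣≤1+∣p∣ s)
  (s≤s (≤-trans (p⊆q⇒∣p∣≤∣q∣ λ y∈ → drop-there (p⊆q (there y∈) λ ())) (∣p∣≤∣x∷p∣ t q)))
  where
  ∣s∷p∣≤1+∣p∣ : ∀ s → ∣ s ∷ p ∣ ≤ suc ∣ p ∣
  ∣s∷p∣≤1+∣p∣ inside  = ≤-refl
  ∣s∷p∣≤1+∣p∣ outside = n≤1+n _
∣p∣≤1+∣q∣ {p = outside ∷ p} {t ∷ q} (suc x) p⊆q = ≤-trans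
  (∣p∣≤1+∣q∣ x λ y∈ y≢x → drop-there (p⊆q (there y∈) (y≢x ∘ Fin.suc-injective)))
  (s≤s (∣p∣≤∣x∷p∣ t q))
∣p∣≤1+∣q∣ {p = inside ∷ p} {t ∷ q} (suc x) p⊆q with p⊆q here (λ ())
... | here = s≤s
  (∣p∣≤1+∣q∣ x λ y∈ y≢x → drop-there (p⊆q (there y∈) (y≢x ∘ Fin.suc-injective)))

∣p∣≤1+∣p-x∣ : ∀ (p : Subset n) x → ∣ p ∣ ≤ suc ∣ p - x ∣
∣p∣≤1+∣p-x∣ p x = ∣p∣≤1+∣q∣ {p = p} x x∈p∧x≢y⇒x∈p-y

-- Removing `x` a second time would make the set strictly smaller, yet it changes nothing.
x∉p-x : ∀ (p : Subset n) x → x ∉ p - x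
x∉p-x p x x∈ = ⊂-irref (p─q─q≡p─q p ⁅ x ⁆) (x∈p⇒p-x⊂p x∈)

∉⇒lookup : ∀ {p : Subset n} {x} → x ∉ p → lookup p x ≡ false
∉⇒lookup {p = p} {x} x∉ with lookup p x in eq
... | false = refl
... | true  = contradiction (lookup⇒[]= x p eq) x∉

-- The weight argument for the upper bound

-- With k = ∣ S ∣ and q = k − 1, this is the optimal fractional cover of the
-- trees connecting S, scaled by 2kq: a tree within S has q edges of total
-- weight 2k each, any other tree has at least k edges meeting S.
weight : Subset n → ℕ → Fin n → Fin n → ℕ
weight S q u v = if lookup S u then (if lookup S v then suc q else q + q) else 0

-- Each non-root vertex pays for its parent edge. If the component stays within `S`, the root lies
-- in `S` and the other q vertices pay 2k each; otherwise the root can be placed outside `S` and all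
-- k vertices of `S` pay at least 2q each. Both give 2kq.
connecting⇒weight : ∀ {E : Rel (Fin n) 0ℓ} → Symmetric E → (E? : Decidable₂ E) →
  ∀ {S q} → ∣ S ∣ ≡ suc q → Nonempty S → Connecting E S →
  suc q * (q + q) ≤ ∑∑ (λ u v → ind (E? u v) * weight S q u v)
connecting⇒weight {n} {E} E-sym E? {S} {q} ∣S∣≡ (r , r∈) conn
  with spanningTree {r = r} E?
... | t , t-closed with any? (λ x → ¬? (x ∈? S) ×-dec x ∈? RootedTree.vertices t)
... | no none = begin
    suc q * (q + q)           ≡⟨ shape q ⟩
    q * (suc q + suc q)
      ≤⟨ *-monoˡ-≤ (suc q + suc q)
           (s≤s⁻¹ (subst (_≤ suc ∣ S - r ∣) ∣S∣≡ (∣p∣≤1+∣p-x∣ S r))) ⟩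
    ∣ S - r ∣ * (suc q + suc q)
      ≤⟨ parentEdges≤weight E-sym E? (weight S q)
           parent depth (S - r) (suc q + suc q) climbS ⟩
    ∑∑ (λ u v → ind (E? u v) * weight S q u v) ∎
  where
  open RootedTree t
  open ≤-Reasoning
  shape : ∀ q → suc q * (q + q) ≡ q * (suc q + suc q)
  shape = solve-∀

  climbS : ∀ {u} → u ∈ S - r → E (parent u) u × depth (parent u) < depth u ×
           suc q + suc q ≤ weight S q u (parent u) + weight S q (parent u) u
  climbS {u} u∈S-r with p─q⊆p _ _ u∈S-r
  ... | u∈S with climb (reachable⇒∈ t t-closed root∈ (conn _ _ r∈ u∈S))
                       (λ { refl → x∉p-x S r u∈S-r })
  ...   | p∈ , pu , p< with parent u ∈? S
  ...     | no p∉S = contradiction (parent u , p∉S , p∈) none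
  ...     | yes p∈S rewrite []=⇒lookup u∈S | []=⇒lookup p∈S = pu , p< , ≤-refl
connecting⇒weight {n} {E} E-sym E? {S} {q} ∣S∣≡ (r , r∈) conn
    | t , t-closed | yes (x , x∉S , x∈t) = begin
    suc q * (q + q)           ≡⟨ cong (_* (q + q)) ∣S∣≡ ⟨
    ∣ S ∣ * (q + q)
      ≤⟨ parentEdges≤weight E-sym E? (weight S q) parent depth S (q + q) climbS ⟩
    ∑∑ (λ u v → ind (E? u v) * weight S q u v) ∎
  where
  open ≤-Reasoning
  -- The tree is grown afresh from `x`, outside `S`, so that no vertex of `S` is the root and lacks
  -- a parent edge.
  spanning = spanningTree {r = x} E?
  t′ = proj₁ spanning
  open RootedTree t′

  x⇝r : Star E x r
  x⇝r = Star.map (treeEdge⇒E t E-sym) (root-path t x∈t)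

  climbS : ∀ {u} → u ∈ S → E (parent u) u × depth (parent u) < depth u ×
           q + q ≤ weight S q u (parent u) + weight S q (parent u) u
  climbS {u} u∈S with climb (reachable⇒∈ t′ (proj₂ spanning) root∈ (x⇝r ◅◅ conn _ _ r∈ u∈S))
                            (λ { refl → x∉S u∈S })
  ... | p∈ , pu , p< with parent u ∈? S
  ...   | yes p∈S rewrite []=⇒lookup u∈S | []=⇒lookup p∈S =
    pu , p< , +-mono-≤ (n≤1+n q) (n≤1+n q)
  ...   | no  p∉S rewrite []=⇒lookup u∈S | ∉⇒lookup p∉S = pu , p< , m≤m+n _ _

-- The sum includes the diagonal, k entries of weight k each; this excess k² is removed later by the
-- class of the diagonal.
∑∑-weight : ∀ (S : Subset n) q → ∣ S ∣ ≡ suc q →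
            ∑∑ (weight S q) ≡ suc q * (suc q * suc q + ∣ ∁ S ∣ * (q + q))
∑∑-weight {n} S q ∣S∣≡ = begin
  ∑∑ (weight S q)                                    ≡⟨ sum-cong-≗ row ⟩
  sum (λ u → if lookup S u then rowSum else 0)       ≡⟨ sum-if S rowSum 0 ⟩
  ∣ S ∣ * rowSum + ∣ ∁ S ∣ * 0
    ≡⟨ cong₂ _+_ (cong (_* rowSum) ∣S∣≡) (*-zeroʳ ∣ ∁ S ∣) ⟩
  suc q * rowSum + 0                                 ≡⟨ +-identityʳ _ ⟩
  suc q * rowSum                                     ∎
  where
  open ≡-Reasoning
  rowSum = suc q * suc q + ∣ ∁ S ∣ * (q + q)

  row : ∀ u → sum (weight S q u) ≡ (if lookup S u then rowSum else 0)
  row u with lookup S u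
  ... | true  = trans (sum-if S (suc q) (q + q))
                      (cong (λ k → k * suc q + ∣ ∁ S ∣ * (q + q)) ∣S∣≡)
  ... | false = sum-replicate-zero n

module _ (G : Graph n) (S : Subset n) (q : ℕ) (∣S∣≡ : ∣ S ∣ ≡ suc q) (S≢∅ : Nonempty S)
         (c : Colouring n m) (conn : Connects G c S) where

  -- The diagonal counts as one more class, disjoint from the others because
  -- adjacency is irreflexive.
  private
    Class₀ : Fin (suc m) → Fin n → Fin n → Set
    Class₀ zero    u v = u ≡ v
    Class₀ (suc i) u v = Class G c i u v

    class₀? : ∀ i u v → Dec (Class₀ i u v)
    class₀? zero    u v = u ≟ v
    class₀? (suc i) u v = class? G c i u v

    exclusive : ∀ u v i j → Class₀ i u v → Class₀ j u v → i ≡ j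
    exclusive u v zero    zero    _ _ = refl
    exclusive u v zero    (suc j) u≡v (uv , _) = contradiction uv (Graph.adj-irrefl G u≡v)
    exclusive u v (suc i) zero    (uv , _) u≡v = contradiction uv (Graph.adj-irrefl G u≡v)
    exclusive u v (suc i) (suc j) (_ , cᵢ , _) (_ , cⱼ , _) = trans (sym cᵢ) cⱼ

    w = weight S q

    classWeight : Fin (suc m) → ℕ
    classWeight i = ∑∑ (λ u v → ind (class₀? i u v) * w u v)

    total : sum classWeight ≤ ∑∑ w
    total = begin
      sum (λ i → sum (λ u → sum (λ v → ind (class₀? i u v) * w u v)))
        ≡⟨ ∑-comm (λ i u → sum (λ v → ind (class₀? i u v) * w u v)) ⟩
      sum (λ u → sum (λ i → sum (λ v → ind (class₀? i u v) * w u v)))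
        ≡⟨ sum-cong-≗ (λ u → ∑-comm (λ i v → ind (class₀? i u v) * w u v)) ⟩
      ∑∑ (λ u v → sum (λ i → ind (class₀? i u v) * w u v))
        ≡⟨ ∑∑-cong (λ u v → *-distribʳ-sum (w u v) (λ i → ind (class₀? i u v))) ⟨
      ∑∑ (λ u v → sum (λ i → ind (class₀? i u v)) * w u v)
        ≤⟨ sum-mono (λ u → sum-mono (λ v → *-monoˡ-≤ (w u v)
             (exclusive⇒sum≤1 (λ i → class₀? i u v) (exclusive u v)))) ⟩
      ∑∑ (λ u v → 1 * w u v)
        ≡⟨ ∑∑-cong (λ u v → *-identityˡ (w u v)) ⟩
      ∑∑ w ∎
      where open ≤-Reasoning

    diagonal : suc q * suc q ≤ classWeight zero
    diagonal = subst (λ k → k * suc q ≤ classWeight zero) ∣S∣≡ (∣p∣*b≤sum S _ (suc q) row)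
      where
      row : ∀ {u} → u ∈ S → suc q ≤ sum (λ v → ind (u ≟ v) * w u v)
      row {u} u∈ = ≤-trans (≤-reflexive (sym uu)) (term≤sum (λ v → ind (u ≟ v) * w u v) u)
        where
        uu : ind (u ≟ u) * w u u ≡ suc q
        uu rewrite ind≡1 (u ≟ u) refl | []=⇒lookup u∈ = *-identityˡ (suc q)

  -- The m classes weigh at least 2kq each and the diagonal at least k². Subtracting k² from the
  -- total weight leaves kq(k + 2(n - k)), and cancelling kq gives the bound on 2m. Staying with 2m
  -- postpones the rounding.
  colours-bound : .{{NonZero q}} → m + m ≤ suc q + (∣ ∁ S ∣ + ∣ ∁ S ∣)
  colours-bound = *-cancelˡ-≤ (suc q * q) {{m*n≢0 (suc q) q}}
    (+-cancelˡ-≤ (suc q * suc q) _ _ (begin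
    suc q * suc q + suc q * q * (m + m)         ≡⟨ cong (suc q * suc q +_) (shape₁ q m) ⟩
    suc q * suc q + m * (suc q * (q + q))
      ≤⟨ +-mono-≤ diagonal (n*b≤sum (classWeight ∘ suc) _ λ i →
           connecting⇒weight (class-sym G c i) (class? G c i) ∣S∣≡ S≢∅ (conn i)) ⟩
    sum classWeight                             ≤⟨ total ⟩
    ∑∑ w                                        ≡⟨ ∑∑-weight S q ∣S∣≡ ⟩
    suc q * (suc q * suc q + ∣ ∁ S ∣ * (q + q)) ≡⟨ shape₂ q ∣ ∁ S ∣ ⟩
    suc q * suc q + suc q * q * (suc q + (∣ ∁ S ∣ + ∣ ∁ S ∣)) ∎))
    where
    open ≤-Reasoning
    shape₁ : ∀ q m → suc q * q * (m + m) ≡ m * (suc q * (q + q))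
    shape₁ = solve-∀
    shape₂ : ∀ q e → suc q * (suc q * suc q + e * (q + q)) ≡
                     suc q * suc q + suc q * q * (suc q + (e + e))
    shape₂ = solve-∀

-- Rounding, and the bound for a set of size k

⌊m+m+n/2⌋≡m+⌊n/2⌋ : ∀ m n → ⌊ m + m + n /2⌋ ≡ m + ⌊ n /2⌋
⌊m+m+n/2⌋≡m+⌊n/2⌋ zero    n = refl
⌊m+m+n/2⌋≡m+⌊n/2⌋ (suc m) n rewrite +-suc m m = cong suc (⌊m+m+n/2⌋≡m+⌊n/2⌋ m n)

-- The right-hand form is the one that halving produces and that the complete graph realises:
-- vertices outside `S` plus pairs inside `S`.
n∸⌈k/2⌉≡ : ∀ {n k} → k ≤ n → n ∸ ⌈ k /2⌉ ≡ (n ∸ k) + ⌊ k /2⌋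
n∸⌈k/2⌉≡ {n} {k} k≤n = begin
  n ∸ ⌈ k /2⌉                         ≡⟨ cong (_∸ ⌈ k /2⌉) (m∸n+n≡m k≤n) ⟨
  n ∸ k + k ∸ ⌈ k /2⌉                 ≡⟨ +-∸-assoc (n ∸ k) (⌈n/2⌉≤n k) ⟩
  n ∸ k + (k ∸ ⌈ k /2⌉)
    ≡⟨ cong (λ x → n ∸ k + (x ∸ ⌈ k /2⌉)) (⌊n/2⌋+⌈n/2⌉≡n k) ⟨
  n ∸ k + (⌊ k /2⌋ + ⌈ k /2⌉ ∸ ⌈ k /2⌉)
    ≡⟨ cong (n ∸ k +_) (m+n∸n≡m ⌊ k /2⌋ ⌈ k /2⌉) ⟩
  n ∸ k + ⌊ k /2⌋                     ∎
  where open ≡-Reasoning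

∣p∣>0⇒nonempty : {p : Subset n} → 0 < ∣ p ∣ → Nonempty p
∣p∣>0⇒nonempty {n} {p} 0<∣p∣ with nonempty? p
... | yes p≢∅ = p≢∅
... | no  p≡∅ = contradiction
  (subst (0 <_) (trans (cong ∣_∣ (Empty-unique p≡∅)) (∣⊥∣≡0 n)) 0<∣p∣) λ ()

∣p∣≥2⇒p-x-nonempty : ∀ (p : Subset n) x → 2 ≤ ∣ p ∣ → Nonempty (p - x)
∣p∣≥2⇒p-x-nonempty p x 2≤∣p∣ =
  ∣p∣>0⇒nonempty (s≤s⁻¹ (≤-trans 2≤∣p∣ (∣p∣≤1+∣p-x∣ p x)))

subset-of-size : ∀ {n k} → k ≤ n → ∃ λ (p : Subset n) → ∣ p ∣ ≡ k
subset-of-size {zero}  z≤n = [] , refl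
subset-of-size {suc n} z≤n = ⊥ , ∣⊥∣≡0 (suc n)
subset-of-size (s≤s k≤n) with subset-of-size k≤n
... | p , ∣p∣≡k = inside ∷ p , cong suc ∣p∣≡k

trees-bound : ∀ (G : Graph n) {S k m} → 2 ≤ k → ∣ S ∣ ≡ k → HasDisjointTrees G S m →
              m ≤ (n ∸ k) + ⌊ k /2⌋
trees-bound {n} G {S} {k@(suc q@(suc _))} {m} (s≤s (s≤s _)) ∣S∣≡k trees
  with c , conn ← treeColouring G trees = begin
  m                            ≡⟨ n≡⌊n+n/2⌋ m ⟩
  ⌊ m + m /2⌋
    ≤⟨ ⌊n/2⌋-mono (colours-bound G S q ∣S∣≡k
         (∣p∣>0⇒nonempty (subst (0 <_) (sym ∣S∣≡k) z<s)) c conn) ⟩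
  ⌊ k + (∣ ∁ S ∣ + ∣ ∁ S ∣) /2⌋   ≡⟨ cong ⌊_/2⌋ (+-comm k _) ⟩
  ⌊ ∣ ∁ S ∣ + ∣ ∁ S ∣ + k /2⌋     ≡⟨ ⌊m+m+n/2⌋≡m+⌊n/2⌋ ∣ ∁ S ∣ k ⟩
  ∣ ∁ S ∣ + ⌊ k /2⌋
    ≡⟨ cong (_+ ⌊ k /2⌋) (trans (∣∁p∣≡n∸∣p∣ S) (cong (n ∸_) ∣S∣≡k)) ⟩
  n ∸ k + ⌊ k /2⌋              ∎
  where open ≤-Reasoning

-- Existence of λₖ

least : {P : ℕ → Set} → Decidable P → ∀ N → P N → ∃[ l ] P l × (∀ {j} → j < l → ¬ P j)
least P? zero    p = 0 , p , λ ()
least P? (suc N) p with P? 0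
... | yes p₀ = 0 , p₀ , λ ()
... | no ¬p₀ with least (P? ∘ suc) N p
...   | l , pₗ , min = suc l , pₗ , λ
  { {zero}  _         → ¬p₀
  ; {suc j} (s≤s j<l) → min j<l
  }

module _ (G : Graph n) (k : ℕ) (0<k : 0 < k) (k≤n : k ≤ n) where

  private
    nonempty : ∀ {S : Subset n} → ∣ S ∣ ≡ k → Nonempty S
    nonempty ∣S∣≡k = ∣p∣>0⇒nonempty (subst (0 <_) (sym ∣S∣≡k) 0<k)

    Fails : ℕ → Subset n → Set
    Fails l S = ∣ S ∣ ≡ k × ¬ HasDisjointTrees G S (suc l)

    fails? : ∀ l → Decidable (Fails l)
    fails? l S with ∣ S ∣ ℕ.≟ k
    ... | no  ∣S∣≢k = no (∣S∣≢k ∘ proj₁)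
    ... | yes ∣S∣≡k =
      map′ (∣S∣≡k ,_) proj₂ (¬? (hasDisjointTrees? G (nonempty ∣S∣≡k) (suc l)))

  -- λₖ is found as the least l for which some k-set has no l + 1 disjoint trees. By minimality
  -- every k-set has l trees, so that k-set has λ equal to l and no other has less.
  λₖ-between : ∀ {a b} →
    (∀ S → ∣ S ∣ ≡ k → HasDisjointTrees G S a) →
    (∀ S m → ∣ S ∣ ≡ k → HasDisjointTrees G S m → m ≤ b) →
    ∃[ l ] (Isλₖ G k l × a ≤ l × l ≤ b)
  λₖ-between {a} {b} all-a bound with S₀ , ∣S₀∣≡k ← subset-of-size k≤n
    -- The search ends by `b`: any k-set fails there, since b + 1 trees would exceed the bound.
    with least (λ l → anySubset? (fails? l)) b
               (S₀ , ∣S₀∣≡k , λ trees → <-irrefl refl (bound _ _ ∣S₀∣≡k trees))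
  ... | l , (S , ∣S∣≡k , fails) , min =
    l , ((S , ∣S∣≡k , isλ) ,
         λ S′ m ∣S′∣≡k (_ , m-max) → m-max l (all-l l min S′ ∣S′∣≡k)) ,
    proj₂ isλ a (all-a S ∣S∣≡k) , bound S l ∣S∣≡k (proj₁ isλ)
    where
    all-l : ∀ l → (∀ {j} → j < l → ¬ ∃ (Fails j)) → ∀ S → ∣ S ∣ ≡ k → HasDisjointTrees G S l
    all-l zero    _   S ∣S∣≡k = (λ ()) , (λ ()) , λ ()
    all-l (suc l) min S ∣S∣≡k =
      -- Minimality only says that no k-set fails at l; decidability turns this into actual trees.
      decidable-stable (hasDisjointTrees? G (nonempty ∣S∣≡k) (suc l))
        (λ none → min (n<1+n l) (S , ∣S∣≡k , none))

    isλ : Isλ G S l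
    isλ = all-l l min S ∣S∣≡k ,
          λ m trees → ≮⇒≥ (λ l<m → fails (fewerTrees G l<m trees))

  λₖ-exactly : ∀ {a} →
    (∀ S → ∣ S ∣ ≡ k → HasDisjointTrees G S a) →
    (∀ S m → ∣ S ∣ ≡ k → HasDisjointTrees G S m → m ≤ a) → Isλₖ G k a
  λₖ-exactly all-a bound with λₖ-between all-a bound
  ... | l , isλₖ , a≤l , l≤a = subst (Isλₖ G k) (≤-antisym l≤a a≤l) isλₖ

  connected⇒one-tree : Connected G → ∀ S → ∣ S ∣ ≡ k → HasDisjointTrees G S 1
  connected⇒one-tree (_ , walk) S ∣S∣≡k = disjointTrees G {1} (nonempty ∣S∣≡k)
    (λ _ _ → suc zero)
    λ { zero s t _ _ → Star.map (λ uv → uv , refl , refl) (walk ∈⊤ ∈⊤) }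

-- The star attains the lower bound

module _ where
  open Graph

  star : ∀ n → Graph (suc n)
  adj (star n) zero    (suc _) = true
  adj (star n) (suc _) zero    = true
  adj (star n) _       _       = false
  adj-sym (star n) {zero}  {suc _} _ = tt
  adj-sym (star n) {suc _} {zero}  _ = tt
  adj-irrefl (star n) {zero}  refl ()
  adj-irrefl (star n) {suc _} refl ()

star-connected : ∀ n → Connected (star n)
star-connected n = (zero , ∈⊤) , λ {u} {v} _ _ → to-centre u ◅◅ from-centre v
  where
  to-centre : ∀ u → Star (Graph.Adj (star n)) u zero
  to-centre zero    = ε
  to-centre (suc _) = tt ◅ ε
  from-centre : ∀ u → Star (Graph.Adj (star n)) zero u
  from-centre zero    = ε
  from-centre (suc _) = tt ◅ ε

star-trees≤1 : ∀ {S} m → 2 ≤ ∣ S ∣ → HasDisjointTrees (star n) S m → m ≤ 1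
star-trees≤1 0 _ _ = z≤n
star-trees≤1 1 _ _ = ≤-refl
star-trees≤1 {n} {S} (suc (suc m)) 2≤∣S∣ trees
  with c , conn ← treeColouring (star n) trees
  -- One vertex of `S` is not the centre, and a second one forces every class to leave that leaf,
  -- necessarily along its only edge. That edge would then have two colours.
  with leaf , leaf∈ ← ∣p∣≥2⇒p-x-nonempty S zero 2≤∣S∣
  with other , other∈ ← ∣p∣≥2⇒p-x-nonempty S leaf 2≤∣S∣
  = contradiction (trans (sym (pendant-colour zero)) (pendant-colour (suc zero))) λ ()
  where
  first-edge : ∀ i {u v} → u ≢ zero → v ≢ u →
               Star (Class (star n) c i) u v → c u zero ≡ suc i
  first-edge i u≢0 v≢u ε = contradiction refl v≢u
  first-edge i {zero} u≢0 v≢u _ = contradiction refl u≢0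
  first-edge i {suc u} u≢0 v≢u (_◅_ {j = zero} (_ , cu , _) _) = cu

  pendant-colour : ∀ i → c leaf zero ≡ suc i
  pendant-colour i = first-edge i
    (λ { refl → x∉p-x S zero leaf∈ }) (λ { refl → x∉p-x S leaf other∈ })
    (conn i leaf other (p─q⊆p _ _ leaf∈) (p─q⊆p _ _ other∈))

-- The complete graph attains the upper bound

complete : ∀ n → Graph n
complete n = record
  { adj        = λ u v → not ⌊ u ≟ v ⌋
  ; adj-sym    = λ {u} {v} uv →
      fromWitnessFalse (≢-sym (toWitnessFalse {a? = u ≟ v} uv))
  ; adj-irrefl = λ {u} {v} u≡v uv → toWitnessFalse {a? = u ≟ v} uv u≡v
  }

complete-connected : ∀ n → Connected (complete (suc n))
complete-connected n = (zero , ∈⊤) , λ {u} {v} _ _ → walk u v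
  where
  walk : ∀ u v → Star (Graph.Adj (complete (suc n))) u v
  walk u v with u ≟ v
  ... | yes refl = ε
  ... | no  u≢v  = fromWitnessFalse u≢v ◅ ε

module _ (G : Graph n) {S : Subset n} (S≢∅ : Nonempty S) (f : Fin n → Fin n → ℕ)
         (f-sym : ∀ u v → f u v ≡ f v u) where

  -- Labels from `m` on fall to colour zero, so a labelling need not be bounded by the number of
  -- trees.
  labelling⇒trees : (∀ x → x < m → Connecting (λ u v → Graph.Adj G u v × f u v ≡ x) S) →
                    HasDisjointTrees G S m
  labelling⇒trees {m} conn = disjointTrees G S≢∅ c λ i s t s∈ t∈ → Star.map
    (λ { {u} {v} (uv , fuv) →
      uv , c-label i u v fuv , c-label i v u (trans (f-sym v u) fuv) })
    (conn (toℕ i) (toℕ<n i) s t s∈ t∈)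
    where
    c : Colouring n m
    c u v with f u v <? m
    ... | yes f<m = suc (fromℕ< f<m)
    ... | no  _   = zero

    c-label : ∀ i u v → f u v ≡ toℕ i → c u v ≡ suc i
    c-label i u v fuv with f u v <? m
    ... | yes f<m = cong suc (toℕ-injective (trans (toℕ-fromℕ< f<m) fuv))
    ... | no  f≮m = contradiction (subst (_< m) (sym fuv) (toℕ<n i)) f≮m

-- The rank of a vertex: the number of elements of the subset that precede it.
position : Subset n → Fin n → ℕ
position (_       ∷ p) zero    = 0
position (inside  ∷ p) (suc x) = suc (position p x)
position (outside ∷ p) (suc x) = position p x

position-surjective : ∀ (p : Subset n) {j} → j < ∣ p ∣ → ∃[ x ] (x ∈ p × position p x ≡ j)
position-surjective (inside ∷ p) {zero}  _         = zero , here , refl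
position-surjective (inside ∷ p) {suc j} (s≤s j<) with position-surjective p j<
... | x , x∈ , eq = suc x , there x∈ , cong suc eq
position-surjective (outside ∷ p) j< with position-surjective p j<
... | x , x∈ , eq = suc x , there x∈ , eq

-- The vertices of S are paired as {aᵢ, bᵢ}, with a last one left over when
-- ∣ S ∣ is odd. Tree i < ⌊∣ S ∣/2⌋ is the double star with central edge aᵢbᵢ;
-- of the four edges between two pairs i < j, it gets aᵢaⱼ and bᵢbⱼ while
-- tree j gets aᵢbⱼ and bᵢaⱼ. The other trees are the stars from the vertices
-- outside S.
module DoubleStars (S : Subset n) where

  level : Fin n → ℕ
  level u = ⌊ position S u /2⌋

  side : Fin n → Bool
  side u = does (position S u ℕ.≟ level u + level u)

  inner : Fin n → Fin n → ℕ
  inner u v = if side u xor side v then level u ⊔ level v else level u ⊓ level v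

  outer : Fin n → ℕ
  outer v = ⌊ ∣ S ∣ /2⌋ + position (∁ S) v

  -- Classes may receive stray edges. Pairs outside `S` get the default 0. When ∣ S ∣ is odd, the
  -- leftover vertex has level ⌊∣ S ∣/2⌋ and the side of the `aᵢ`, so its edges to the `bᵢ` share
  -- the label of the first outer star. Neither harms connectivity.
  label : Fin n → Fin n → ℕ
  label u v = if lookup S u then (if lookup S v then inner u v else outer v)
                            else (if lookup S v then outer u else 0)

  inner-sym : ∀ u v → inner u v ≡ inner v u
  inner-sym u v rewrite xor-comm (side u) (side v) | ⊔-comm (level u) (level v)
                      | ⊓-comm (level u) (level v) = refl

  label-sym : ∀ u v → label u v ≡ label v u
  label-sym u v with lookup S u | lookup S v
  ... | true  | true  = inner-sym u v
  ... | true  | false = refl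
  ... | false | true  = refl
  ... | false | false = refl

  Labelled : ℕ → Fin n → Fin n → Set
  Labelled x u v = Graph.Adj (complete n) u v × label u v ≡ x

  labelled-sym : ∀ {x u v} → Labelled x u v → Labelled x v u
  labelled-sym {u = u} {v} (uv , eq) =
    Graph.adj-sym (complete n) {u} {v} uv , trans (label-sym v u) eq

  hub⇒connecting : ∀ {x} h → (∀ {u} → u ∈ S → Star (Labelled x) u h) →
                   Connecting (Labelled x) S
  hub⇒connecting h to-hub s t s∈ t∈ =
    to-hub s∈ ◅◅ reverse (λ {u} {v} → labelled-sym {u = u} {v}) (to-hub t∈)

  -- Allowing `u` and `v` to coincide spares the hubs a separate case.
  link : ∀ {x} u v → label u v ≡ x → Star (Labelled x) u v
  link u v eq with u ≟ v
  ... | yes refl = ε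
  ... | no  u≢v  = (fromWitnessFalse u≢v , eq) ◅ ε

  inner-link : ∀ {x u v} → u ∈ S → v ∈ S → inner u v ≡ x → Star (Labelled x) u v
  inner-link {x} {u} {v} u∈ v∈ eq = link u v lemma
    where
    lemma : label u v ≡ x
    lemma rewrite []=⇒lookup u∈ | []=⇒lookup v∈ = eq

  outer-connecting : ∀ {j} → j < ∣ ∁ S ∣ → Connecting (Labelled (⌊ ∣ S ∣ /2⌋ + j)) S
  outer-connecting {j} j< with position-surjective (∁ S) j<
  ... | h , h∈ , eq = hub⇒connecting h λ {u} u∈ → link u h (lemma u∈)
    where
    lemma : ∀ {u} → u ∈ S → label u h ≡ ⌊ ∣ S ∣ /2⌋ + j
    lemma u∈ rewrite []=⇒lookup u∈ | ∉⇒lookup (x∈∁p⇒x∉p h∈) = cong (_ +_) eq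

  inner-connecting : ∀ {x} → x < ⌊ ∣ S ∣ /2⌋ → Connecting (Labelled x) S
  inner-connecting {x} x<
    with position-surjective S {x + x} (<-trans (n<1+n _) 1+2x<)
       | position-surjective S {suc (x + x)} 1+2x<
    where
    1+2x< : suc (x + x) < ∣ S ∣
    1+2x< = begin
      suc (suc (x + x))          ≡⟨ cong suc (+-suc x x) ⟨
      suc x + suc x              ≤⟨ +-mono-≤ x< (≤-trans x< (⌊n/2⌋≤⌈n/2⌉ ∣ S ∣)) ⟩
      ⌊ ∣ S ∣ /2⌋ + ⌈ ∣ S ∣ /2⌉  ≡⟨ ⌊n/2⌋+⌈n/2⌉≡n ∣ S ∣ ⟩
      ∣ S ∣                      ∎
      where open ≤-Reasoning
  ... | a , a∈ , a-pos | b , b∈ , b-pos = hub⇒connecting a to-hub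
    where
    a-level : level a ≡ x
    a-level = trans (cong ⌊_/2⌋ a-pos) (sym (n≡⌊n+n/2⌋ x))

    b-level : level b ≡ x
    b-level = trans (cong ⌊_/2⌋ b-pos) (sym (n≡⌈n+n/2⌉ x))

    a-side : side a ≡ true
    a-side = dec-true (position S a ℕ.≟ level a + level a)
      (trans a-pos (sym (cong₂ _+_ a-level a-level)))

    b-side : side b ≡ false
    b-side = dec-false (position S b ℕ.≟ level b + level b)
      λ eq → 1+n≢n (trans (sym b-pos) (trans eq (cong₂ _+_ b-level b-level)))

    b⇝a : Star (Labelled x) b a
    b⇝a = inner-link b∈ a∈ lemma
      where
      lemma : inner b a ≡ x
      lemma rewrite a-side | b-side | a-level | b-level = ⊔-idem x

    to-hub : ∀ {u} → u ∈ S → Star (Labelled x) u a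
    -- A vertex of level at most x hangs on the centre of the opposite side, where the label is the
    -- maximum of the levels; one of level at least x hangs on the centre of its own side, where it
    -- is the minimum. Both equal x.
    to-hub {u} u∈ with side u in u-side | ≤-total (level u) x
    ... | true  | inj₁ u≤x = inner-link u∈ b∈ lemma ◅◅ b⇝a
      where
      lemma : inner u b ≡ x
      lemma rewrite u-side | b-side | b-level = m≤n⇒m⊔n≡n u≤x
    ... | false | inj₁ u≤x = inner-link u∈ a∈ lemma
      where
      lemma : inner u a ≡ x
      lemma rewrite u-side | a-side | a-level = m≤n⇒m⊔n≡n u≤x
    ... | true  | inj₂ x≤u = inner-link u∈ a∈ lemma
      where
      lemma : inner u a ≡ x
      lemma rewrite u-side | a-side | a-level = m≥n⇒m⊓n≡n x≤u
    ... | false | inj₂ x≤u = inner-link u∈ b∈ lemma ◅◅ b⇝a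
      where
      lemma : inner u b ≡ x
      lemma rewrite u-side | b-side | b-level = m≥n⇒m⊓n≡n x≤u

complete-trees : ∀ {S : Subset n} {k} → 0 < k → ∣ S ∣ ≡ k →
                 HasDisjointTrees (complete n) S (n ∸ k + ⌊ k /2⌋)
complete-trees {n} {S} 0<k refl =
  labelling⇒trees (complete n) (∣p∣>0⇒nonempty 0<k) label label-sym connecting
  where
  open DoubleStars S
  connecting : ∀ x → x < n ∸ ∣ S ∣ + ⌊ ∣ S ∣ /2⌋ → Connecting (Labelled x) S
  connecting x x< with x <? ⌊ ∣ S ∣ /2⌋
  ... | yes x<t = inner-connecting x<t
  ... | no  x≮t = subst (λ y → Connecting (Labelled y) S) (m+[n∸m]≡n t≤x) (outer-connecting
    (+-cancelˡ-< t _ _ (begin-strict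
      t + (x ∸ t)          ≡⟨ m+[n∸m]≡n t≤x ⟩
      x                    <⟨ x< ⟩
      n ∸ ∣ S ∣ + t        ≡⟨ +-comm (n ∸ ∣ S ∣) t ⟩
      t + (n ∸ ∣ S ∣)      ≡⟨ cong (t +_) (∣∁p∣≡n∸∣p∣ S) ⟨
      t + ∣ ∁ S ∣          ∎)))
    where
    open ≤-Reasoning
    t = ⌊ ∣ S ∣ /2⌋
    t≤x = ≮⇒≥ x≮t

proposition2 : (n k : ℕ) → 3 ≤ k → k ≤ n →
    ((G : Graph n) → Connected G →
    ∃[ l ] (Isλₖ G k l × 1 ≤ l × l ≤ n ∸ ⌈ k /2⌉))
    × (Σ[ G ∈ Graph n ] (Connected G × Isλₖ G k (n ∸ ⌈ k /2⌉)))
    × (Σ[ G ∈ Graph n ] (Connected G × Isλₖ G k 1))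
proposition2 (suc n) k 3≤k@(s≤s _) k≤n@(s≤s _) rewrite n∸⌈k/2⌉≡ k≤n =
  (λ G conn → λₖ-between G k 0<k k≤n (connected⇒one-tree G k 0<k k≤n conn) (bound G)) ,
  (complete (suc n) , complete-connected n ,
    λₖ-exactly (complete (suc n)) k 0<k k≤n
      (λ S → complete-trees 0<k) (bound (complete (suc n)))) ,
  (star n , star-connected n ,
    λₖ-exactly (star n) k 0<k k≤n
      (connected⇒one-tree (star n) k 0<k k≤n (star-connected n))
      (λ S m ∣S∣≡k → star-trees≤1 m (subst (2 ≤_) (sym ∣S∣≡k) 2≤k)))
  where
  2≤k : 2 ≤ k
  2≤k = <⇒≤ 3≤k

  0<k : 0 < k
  0<k = <⇒≤ 2≤k

  bound : (G : Graph (suc n)) → ∀ S m → ∣ S ∣ ≡ k → HasDisjointTrees G S m →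
          m ≤ suc n ∸ k + ⌊ k /2⌋
  bound G S m = trees-bound G 2≤k
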